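{- Let $\Gamma,\Delta$ be finite multisets of formulas and $\Sigma$ a finite multiset of outmost-boxed formulas. For every propositional variable $p$ and every agent symbol $a$ there exists a formula $A$ such that: (i) $\mathsf{V}(A)\subseteq\mathsf{V}(\Sigma\cup\Gamma\cup\Delta)\setminus\{p\}$ and $\mathsf{Agt}(A)\subseteq\mathsf{Agt}(\Sigma\cup\Gamma\cup\Delta)\setminus\{a\}$; (ii) $\mathsf{G}(\mathbf{KT}^+_D)\vdash\Sigma\mid\Gamma,A\Rightarrow\Delta$; (iii) for all finite multisets $\Pi,\Lambda$ of formulas and every finite multiset $\Theta$ of outmost-boxed formulas with $p\notin\mathsf{V}(\Pi\cup\Lambda\cup\Theta)$ and $a\notin\mathsf{Agt}(\Pi\cup\Lambda\cup\Theta)$: if $\mathsf{G}(\mathbf{KT}^+_D)\vdash\Theta,\Sigma\mid\Pi,\Gamma\Rightarrow\Delta,\Lambda$, then $\mathsf{G}(\mathbf{KT}^+_D)\vdash\emptyset\mid\Theta,\Pi\Rightarrow A,\Lambda$.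
   Context: Language: fix a finite nonempty set $\mathsf{Agt}$ of agent symbols and a countable set $\mathsf{Prop}$ of propositional variables; $\mathsf{Grp}$ is the set of nonempty subsets of $\mathsf{Agt}$. Formulas: $\alpha::=p\mid\bot\mid\alpha\wedge\alpha\mid\alpha\vee\alpha\mid\alpha\rightarrow\alpha\mid\neg\alpha\mid D_G\alpha$ with $p\in\mathsf{Prop}$, $G\in\mathsf{Grp}$. $\mathsf{V}(\cdot)$ is the set of propositional variables occurring, $\mathsf{Agt}(\cdot)$ the set of agent symbols occurring (the union of all $G$ with $D_G$ occurring); for multisets these are unions. An outmost-boxed formula is one of the form $D_G\gamma$. Calculus $\mathsf{G}(\mathbf{KT}^+_D)$: a T-sequent $\Sigma\mid\Gamma\Rightarrow\Delta$ consists of finite multisets $\Gamma,\Delta$ of formulas and a finite multiset $\Sigma$ of outmost-boxed formulas; $\vdash S$ means $S$ is the root of a finite tree built from initial sequents by the rules. Initial sequents: $\Sigma\mid\Gamma,p\Rightarrow p,\Delta$ ($p\in\mathsf{Prop}$) and $\Sigma\mid\bot,\Gamma\Rightarrow\Delta$. Propositional rules (with $\Sigma$ unchanged): $(R\wedge)$ from $\Sigma\mid\Gamma\Rightarrow\Delta,\alpha_1$ and $\Sigma\mid\Gamma\Rightarrow\Delta,\alpha_2$ infer $\Sigma\mid\Gamma\Rightarrow\Delta,\alpha_1\wedge\alpha_2$; $(L\wedge)$ from $\Sigma\mid\alpha_1,\alpha_2,\Gamma\Rightarrow\Delta$ infer $\Sigma\mid\alpha_1\wedge\alpha_2,\Gamma\Rightarrow\Delta$;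 $(R\vee)$ from $\Sigma\mid\Gamma\Rightarrow\Delta,\alpha_1,\alpha_2$ infer $\Sigma\mid\Gamma\Rightarrow\Delta,\alpha_1\vee\alpha_2$; $(L\vee)$ from $\Sigma\mid\alpha_1,\Gamma\Rightarrow\Delta$ and $\Sigma\mid\alpha_2,\Gamma\Rightarrow\Delta$ infer $\Sigma\mid\alpha_1\vee\alpha_2,\Gamma\Rightarrow\Delta$; $(R\rightarrow)$ from $\Sigma\mid\alpha_1,\Gamma\Rightarrow\Delta,\alpha_2$ infer $\Sigma\mid\Gamma\Rightarrow\Delta,\alpha_1\rightarrow\alpha_2$; $(L\rightarrow)$ from $\Sigma\mid\Gamma\Rightarrow\Delta,\alpha_1$ and $\Sigma\mid\alpha_2,\Gamma\Rightarrow\Delta$ infer $\Sigma\mid\alpha_1\rightarrow\alpha_2,\Gamma\Rightarrow\Delta$; $(R\neg)$ from $\Sigma\mid\alpha,\Gamma\Rightarrow\Delta$ infer $\Sigma\mid\Gamma\Rightarrow\Delta,\neg\alpha$; $(L\neg)$ from $\Sigma\mid\Gamma\Rightarrow\Delta,\alpha$ infer $\Sigma\mid\neg\alpha,\Gamma\Rightarrow\Delta$. Modal rules: $(D_K^+)$: from $\emptyset\mid\alpha_1,\dots,\alpha_n\Rightarrow\beta$ ($n\ge0$) infer $\Sigma,D_{G_1}\alpha_1,\dots,D_{G_n}\alpha_n\mid\Pi\Rightarrow D_G\beta,\Omega$, provided $G_i\subseteq G$ for all $i$, $\Sigma$ consists only of formulas $D_H\gamma$ with $H\not\subseteq G$,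 $\Pi$ consists only of propositional variables and $\bot$, and $\Omega$ only of propositional variables, $\bot$ and outmost-boxed formulas; $(D_T^+)$: from $D_G\alpha,\Sigma\mid\Gamma,\alpha\Rightarrow\Delta$ infer $\Sigma\mid\Gamma,D_G\alpha\Rightarrow\Delta$. -}

module Defs where

open import Data.Nat using (ℕ)
open import Data.Fin using (Fin)
open import Data.Fin.Subset as Subset using (Subset; Nonempty)
open import Data.List using (List; []; _∷_; [_]; _++_; map)
open import Data.List.Relation.Unary.All using (All)
open import Data.List.Relation.Unary.Any using (Any)
open import Data.List.Relation.Binary.Permutation.Propositional using (_↭_)
open import Data.Product using (_×_; _,_; proj₁; proj₂; uncurry)
open import Level using (0ℓ)
open import Relation.Unary using (Pred; _∈_; _∪_; ∅; ｛_｝)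

-- The finite set of agent symbols is Fin n.
-- Nonemptiness is irrelevant, so groups with the same members are equal.
record Grp (n : ℕ) : Set where
  constructor mkGrp
  field
    members   : Subset n
    .nonempty : Nonempty members

open Grp public

infixr 8 _∧ᶠ_
infixr 7 _∨ᶠ_
infixr 6 _→ᶠ_
infix  9 ¬ᶠ_

data Form (n : ℕ) (Var : Set) : Set where
  var  : Var → Form n Var
  ⊥ᶠ   : Form n Var
  _∧ᶠ_ : Form n Var → Form n Var → Form n Var
  _∨ᶠ_ : Form n Var → Form n Var → Form n Var
  _→ᶠ_ : Form n Var → Form n Var → Form n Var
  ¬ᶠ_  : Form n Var → Form n Var
  D    : Grp n → Form n Var → Form n Var

-- The pair (G , α) stands for the outmost-boxed formula D G α.
Boxed : ℕ → Set → Set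
Boxed n Var = Grp n × Form n Var

private variable
  n   : ℕ
  Var : Set

boxes : List (Boxed n Var) → List (Form n Var)
boxes = map (uncurry D)

V : Form n Var → Pred Var 0ℓ
V (var q)  = ｛ q ｝
V ⊥ᶠ       = ∅
V (α ∧ᶠ β) = V α ∪ V β
V (α ∨ᶠ β) = V α ∪ V β
V (α →ᶠ β) = V α ∪ V β
V (¬ᶠ α)   = V α
V (D G α)  = V α

Agt : Form n Var → Pred (Fin n) 0ℓ
Agt (var q)  = ∅
Agt ⊥ᶠ       = ∅
Agt (α ∧ᶠ β) = Agt α ∪ Agt β
Agt (α ∨ᶠ β) = Agt α ∪ Agt β
Agt (α →ᶠ β) = Agt α ∪ Agt β
Agt (¬ᶠ α)   = Agt α
Agt (D G α)  = (Subset._∈ members G) ∪ Agt α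

V* : List (Form n Var) → Pred Var 0ℓ
V* Γ q = Any (λ α → q ∈ V α) Γ

Agt* : List (Form n Var) → Pred (Fin n) 0ℓ
Agt* Γ b = Any (λ α → b ∈ Agt α) Γ

data Atomic {n : ℕ} {Var : Set} : Pred (Form n Var) 0ℓ where
  atom-var : (q : Var) → Atomic (var q)
  atom-⊥   : Atomic ⊥ᶠ

data OutmostBoxed {n : ℕ} {Var : Set} : Pred (Form n Var) 0ℓ where
  boxed : (G : Grp n) (α : Form n Var) → OutmostBoxed (D G α)

infix 3 ⊢_∣_⇒_

-- Derivability in G(KT⁺_D).  Finite multisets are lists up to permutation;
-- the constructor ≋ identifies sequents that are equal as multisets.
data ⊢_∣_⇒_ {n : ℕ} {Var : Set} : List (Boxed n Var) → List (Form n Var) → List (Form n Var) → Set where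
  ≋   : ∀ {Σ Σ′ Γ Γ′ Δ Δ′} → Σ ↭ Σ′ → Γ ↭ Γ′ → Δ ↭ Δ′ →
        ⊢ Σ ∣ Γ ⇒ Δ → ⊢ Σ′ ∣ Γ′ ⇒ Δ′
  ax  : ∀ {Σ Γ Δ} (q : Var) → ⊢ Σ ∣ var q ∷ Γ ⇒ var q ∷ Δ
  L⊥  : ∀ {Σ Γ Δ} → ⊢ Σ ∣ ⊥ᶠ ∷ Γ ⇒ Δ
  R∧  : ∀ {Σ Γ Δ α β} → ⊢ Σ ∣ Γ ⇒ α ∷ Δ → ⊢ Σ ∣ Γ ⇒ β ∷ Δ → ⊢ Σ ∣ Γ ⇒ α ∧ᶠ β ∷ Δ
  L∧  : ∀ {Σ Γ Δ α β} → ⊢ Σ ∣ α ∷ β ∷ Γ ⇒ Δ → ⊢ Σ ∣ α ∧ᶠ β ∷ Γ ⇒ Δ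
  R∨  : ∀ {Σ Γ Δ α β} → ⊢ Σ ∣ Γ ⇒ α ∷ β ∷ Δ → ⊢ Σ ∣ Γ ⇒ α ∨ᶠ β ∷ Δ
  L∨  : ∀ {Σ Γ Δ α β} → ⊢ Σ ∣ α ∷ Γ ⇒ Δ → ⊢ Σ ∣ β ∷ Γ ⇒ Δ → ⊢ Σ ∣ α ∨ᶠ β ∷ Γ ⇒ Δ
  R→  : ∀ {Σ Γ Δ α β} → ⊢ Σ ∣ α ∷ Γ ⇒ β ∷ Δ → ⊢ Σ ∣ Γ ⇒ α →ᶠ β ∷ Δ
  L→  : ∀ {Σ Γ Δ α β} → ⊢ Σ ∣ Γ ⇒ α ∷ Δ → ⊢ Σ ∣ β ∷ Γ ⇒ Δ → ⊢ Σ ∣ α →ᶠ β ∷ Γ ⇒ Δ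
  R¬  : ∀ {Σ Γ Δ α} → ⊢ Σ ∣ α ∷ Γ ⇒ Δ → ⊢ Σ ∣ Γ ⇒ ¬ᶠ α ∷ Δ
  L¬  : ∀ {Σ Γ Δ α} → ⊢ Σ ∣ Γ ⇒ α ∷ Δ → ⊢ Σ ∣ ¬ᶠ α ∷ Γ ⇒ Δ
  -- Ξ lists the D_{Gᵢ} αᵢ, so map proj₂ Ξ lists the αᵢ.
  DK⁺ : ∀ {Σ Ξ Π Ω G β} →
        All (λ B → members (proj₁ B) Subset.⊆ members G) Ξ →
        All (λ B → members (proj₁ B) Subset.⊈ members G) Σ →
        All Atomic Π →
        All (Atomic ∪ OutmostBoxed) Ω →
        ⊢ [] ∣ map proj₂ Ξ ⇒ [ β ] →
        ⊢ Σ ++ Ξ ∣ Π ⇒ D G β ∷ Ω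
  DT⁺ : ∀ {Σ Γ Δ G α} → ⊢ (G , α) ∷ Σ ∣ α ∷ Γ ⇒ Δ → ⊢ Σ ∣ D G α ∷ Γ ⇒ Δ

{-# OPTIONS --safe #-}
module Submission where

open import Defs
open import Data.Empty using (⊥; ⊥-elim-irr)
open import Data.Fin using (Fin)
open import Data.Fin.Subset as Subset using (Subset; Nonempty; inside; outside; ⁅_⁆; ∁; ⋃; _∩_)
import Data.Fin.Subset.Properties as Subset
open import Data.List using (List; []; _∷_; [_]; _++_; map; filter)
import Data.List.Properties as List
open import Data.List.Membership.Propositional using (_∈_; lose)
open import Data.List.Membership.Propositional.Properties
  using (∈-map⁺; ∈-map⁻; ∈-filter⁺; ∈-filter⁻; ∈-++⁺ˡ; ∈-++⁺ʳ; ∈-++⁻; ∈-∃++)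
open import Data.List.Relation.Binary.Permutation.Propositional
  using (_↭_; ↭-refl; ↭-sym; ↭-reflexive; refl; prep; swap; trans)
open import Data.List.Relation.Binary.Permutation.Propositional.Properties
  using (shift; ∈-resp-↭; All-resp-↭)
open import Data.List.Relation.Binary.Subset.Propositional using () renaming (_⊆_ to _⊑_)
open import Data.List.Relation.Binary.Subset.Propositional.Properties
  using (⊆-refl; ⊆-reflexive; ⊆-trans; ++⁺; ++⁺ʳ; ∷⁺ʳ; ∈-∷⁺ʳ; map⁺; xs⊆ys++xs; ⊆-reflexive-↭)
open import Data.List.Relation.Unary.All as All using (All; []; _∷_)
import Data.List.Relation.Unary.All.Properties as All
open import Data.List.Relation.Unary.Any using (here; there)
open import Data.Maybe using (Maybe; just; nothing)
open import Data.Nat using (ℕ; zero; suc; _+_; _⊔_; _<_; z≤n; s≤s)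
open import Data.Nat.ListAction using (sum)
open import Data.Nat.ListAction.Properties using (sum-++)
import Data.Nat.Properties as ℕ
open import Data.Product using (_×_; _,_; proj₁; proj₂; ∃-syntax; ∃₂; uncurry)
open import Data.Sum using (_⊎_; inj₁; inj₂)
open import Data.Unit using (⊤; tt)
open import Data.Vec using ([]; _∷_)
open import Function using (_∘_; case_of_)
open import Function.Bundles using (_↣_)
open import Level using (0ℓ)
open import Relation.Binary.Definitions using (DecidableEquality)
open import Relation.Binary.PropositionalEquality as ≡ using (_≡_; _≢_; refl; sym; cong; subst)
open import Relation.Nullary using (Dec; yes; no; ¬_; contradiction)
open import Relation.Nullary.Decidable using (map′; ¬?; via-injection)
open import Relation.Unary using (Pred; _∉_; _∪_; _∖_; ｛_｝; _⊆_)

-- The proof is a Pitts-style construction along proof search.  Derivability ⊢ is first replaced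
-- by a cumulative calculus ⊩ on signed formulas, in which principal formulas are kept and the
-- modal rule has no side condition on its context, so that weakening, contraction and inversion
-- are immediate.  Inverting the propositional and T rules reduces the interpolant of Σ ∣ S to
-- those of critical sequents, where only the modal rule is left; unboxing then lowers the modal
-- depth.  For an underivable critical sequent the interpolant is the disjunction of
--   * ¬ q for each variable q ≠ p on the left, and q for each q ≠ p on the right;
--   * D_{G∖a} B for each D_G β on the right, B the interpolant of the unboxed premise
--     (when G = {a}, no boxed formula of the context can take part in that inference);
--   * ¬ D_T ¬ B for each nonempty group T of agents of Σ with a ∉ T, B the interpolant of the
--     bodies of the formulas D_H γ in Σ with H ⊆ T: these meet an inference whose principal
--     formula D_G β lies in the context, T being the trace of G on the agents of Σ.
-- For a derivable critical sequent it is ⊤; this case distinction needs decidability of ⊩.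

-- Lists compared by membership, and finite search

++-idem-⊑ : ∀ {A : Set} (xs : List A) {ys} → xs ++ xs ++ ys ⊑ xs ++ ys
++-idem-⊑ xs m with ∈-++⁻ xs m
... | inj₁ i = ∈-++⁺ˡ i
... | inj₂ i = i

++-comm-⊑ : ∀ {A : Set} (xs ys : List A) {zs} → xs ++ ys ++ zs ⊑ ys ++ xs ++ zs
++-comm-⊑ xs ys m with ∈-++⁻ xs m
... | inj₁ i = ∈-++⁺ʳ ys (∈-++⁺ˡ i)
... | inj₂ i with ∈-++⁻ ys i
...   | inj₁ j = ∈-++⁺ˡ j
...   | inj₂ j = ∈-++⁺ʳ ys (∈-++⁺ʳ xs j)

⊑-under : ∀ {A : Set} {x : A} {xs ys} zs → xs ⊑ x ∷ ys → zs ++ xs ⊑ x ∷ zs ++ ys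
⊑-under {x = x} {ys = ys} zs xs⊆ = ⊆-trans (++⁺ʳ zs xs⊆) (⊆-reflexive-↭ (shift x zs ys))

∈-tail : ∀ {A : Set} {x y : A} {ys} → x ≢ y → x ∈ y ∷ ys → x ∈ ys
∈-tail x≢y (here e)  = contradiction e x≢y
∈-tail x≢y (there m) = m

Every : {A : Set} → (A → Set) → List A → Set
Every Q xs = ∀ {x} → x ∈ xs → Q x

Every-++ : ∀ {A : Set} {Q : A → Set} xs {ys} → Every Q xs → Every Q ys → Every Q (xs ++ ys)
Every-++ xs p q m with ∈-++⁻ xs m
... | inj₁ i = p i
... | inj₂ i = q i

Every-∷ : ∀ {A : Set} {Q : A → Set} {x xs} → Q x → Every Q xs → Every Q (x ∷ xs)
Every-∷ q qs (here refl) = q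
Every-∷ q qs (there m)   = qs m

bounded : ∀ {A : Set} (f : A → ℕ) xs → ∃[ k ] All (λ x → f x < k) xs
bounded f []       = 0 , []
bounded f (x ∷ xs) with k , p ← bounded f xs =
  suc (f x) ⊔ k , ℕ.m≤m⊔n _ k ∷ All.map (λ lt → ℕ.≤-trans lt (ℕ.m≤n⊔m (suc (f x)) k)) p

extract : ∀ {A : Set} {x : A} {xs} → x ∈ xs → ∃[ ys ] xs ↭ x ∷ ys
extract {x = x} m with ys , zs , refl ← ∈-∃++ m = ys ++ zs , shift x ys zs

all-members? : ∀ {A : Set} {Q : A → Set} xs → (∀ {x} → x ∈ xs → Dec (Q x)) → Dec (All Q xs)
all-members? []       q? = yes []
all-members? (x ∷ xs) q? with q? (here refl) | all-members? xs (q? ∘ there)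
... | yes q | yes qs = yes (q ∷ qs)
... | no ¬q | _      = no (¬q ∘ All.head)
... | _     | no ¬qs = no (¬qs ∘ All.tail)

any-member? : ∀ {A : Set} {Q : A → Set} xs → (∀ {x} → x ∈ xs → Dec (Q x)) → Dec (∃[ x ] x ∈ xs × Q x)
any-member? []       q? = no λ ()
any-member? (x ∷ xs) q? with q? (here refl) | any-member? xs (q? ∘ there)
... | yes q | _               = yes (x , here refl , q)
... | no _  | yes (y , m , q) = yes (y , there m , q)
... | no ¬q | no ¬qs          = no λ { (_ , here refl , q) → ¬q q ; (y , there m , q) → ¬qs (y , m , q) }

subsets : ∀ k → List (Subset k)
subsets zero    = [ [] ]
subsets (suc k) = map (inside ∷_) (subsets k) ++ map (outside ∷_) (subsets k)

∈-subsets : ∀ {k} (Z : Subset k) → Z ∈ subsets k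
∈-subsets []            = here refl
∈-subsets (inside ∷ Z)  = ∈-++⁺ˡ (∈-map⁺ _ (∈-subsets Z))
∈-subsets (outside ∷ Z) = ∈-++⁺ʳ (map (inside ∷_) (subsets _)) (∈-map⁺ _ (∈-subsets Z))

module Calculus {n : ℕ} {Var : Set} where

  private
    Fm = Form n Var
    Bx = Boxed n Var

  -- Signed formulas and the cumulative calculus

  data Signed : Set where
    L R : Fm → Signed

  form : Signed → Fm
  form (L α) = α
  form (R α) = α

  Branch : Set
  Branch = List Bx × List Signed

  -- The premises of the propositional and T rules, as additions to the conclusion.
  branches : Signed → Maybe (List Branch)
  branches (L (var q))  = nothing
  branches (L ⊥ᶠ)       = just []
  branches (L (α ∧ᶠ β)) = just [ [] , L α ∷ L β ∷ [] ]
  branches (L (α ∨ᶠ β)) = just (([] , [ L α ]) ∷ ([] , [ L β ]) ∷ [])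
  branches (L (α →ᶠ β)) = just (([] , [ R α ]) ∷ ([] , [ L β ]) ∷ [])
  branches (L (¬ᶠ α))   = just [ [] , [ R α ] ]
  branches (L (D G α))  = just [ [ G , α ] , [ L α ] ]
  branches (R (var q))  = nothing
  branches (R ⊥ᶠ)       = nothing
  branches (R (α ∧ᶠ β)) = just (([] , [ R α ]) ∷ ([] , [ R β ]) ∷ [])
  branches (R (α ∨ᶠ β)) = just [ [] , R α ∷ R β ∷ [] ]
  branches (R (α →ᶠ β)) = just [ [] , L α ∷ R β ∷ [] ]
  branches (R (¬ᶠ α))   = just [ [] , [ L α ] ]
  branches (R (D G α))  = nothing

  -- Critical formulas form only contexts that `DK⁺` admits: variables on the left, where `⊥ᶠ`
  -- counts as a rule without premises, and variables, `⊥ᶠ` and boxed formulas on the right.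
  Critical : Signed → Set
  Critical x = branches x ≡ nothing

  _within?_ : (B : Bx) (Z : Subset n) → Dec (members (proj₁ B) Subset.⊆ Z)
  B within? Z = members (proj₁ B) Subset.⊆? Z

  body : Bx → Signed
  body (_ , α) = L α

  unbox : Subset n → List Bx → List Signed
  unbox Z Σ = map body (filter (_within? Z) Σ)

  ∈-unbox⁺ : ∀ {Z Σ H α} → (H , α) ∈ Σ → members H Subset.⊆ Z → L α ∈ unbox Z Σ
  ∈-unbox⁺ m H⊆Z = ∈-map⁺ body (∈-filter⁺ (_within? _) m H⊆Z)

  ∈-unbox⁻ : ∀ {Z} Σ {x} → x ∈ unbox Z Σ →
             ∃₂ λ H α → (H , α) ∈ Σ × members H Subset.⊆ Z × x ≡ L α
  ∈-unbox⁻ {Z} Σ m with (H , α) , m′ , refl ← ∈-map⁻ body m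
    with i , s ← ∈-filter⁻ (_within? Z) {xs = Σ} m′ = H , α , i , s , refl

  All-unbox : ∀ {Z} {Q : Fm → Set} Σ → (∀ {H α} → (H , α) ∈ Σ → Q α) → All (Q ∘ form) (unbox Z Σ)
  All-unbox {Z} {Q} Σ f = All.tabulate λ m → bodies (∈-unbox⁻ Σ m)
    where
    bodies : ∀ {x} → (∃₂ λ H α → (H , α) ∈ Σ × members H Subset.⊆ Z × x ≡ L α) → Q (form x)
    bodies (_ , _ , i , _ , refl) = f i

  unbox-mono : ∀ {Z Z′ Σ Σ′} → Z Subset.⊆ Z′ → Σ ⊑ Σ′ → unbox Z Σ ⊑ unbox Z′ Σ′
  unbox-mono {Σ = Σ} Z⊆ Σ⊆ m with H , α , i , s , refl ← ∈-unbox⁻ Σ m = ∈-unbox⁺ (Σ⊆ i) (Z⊆ ∘ s)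

  -- The halves get separate bounds: groups of a context shrink because they avoid `a`, groups of
  -- `Σ` because they lie among the agents of `Σ`.
  unbox-++ : ∀ {Z Z₁ Z₂} Θ {Σ} →
             (∀ {B} → B ∈ Θ → members (proj₁ B) Subset.⊆ Z → members (proj₁ B) Subset.⊆ Z₁) →
             (∀ {B} → B ∈ Σ → members (proj₁ B) Subset.⊆ Z → members (proj₁ B) Subset.⊆ Z₂) →
             unbox Z (Θ ++ Σ) ⊑ unbox Z₁ Θ ++ unbox Z₂ Σ
  unbox-++ {Z} {Z₁} Θ {Σ} f g m with _ , _ , i , H⊆Z , refl ← ∈-unbox⁻ (Θ ++ Σ) m with ∈-++⁻ Θ i
  ... | inj₁ j = ∈-++⁺ˡ (∈-unbox⁺ j (f j H⊆Z))
  ... | inj₂ j = ∈-++⁺ʳ (unbox Z₁ Θ) (∈-unbox⁺ j (g j H⊆Z))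

  infix 3 ⊩_∣_

  data ⊩_∣_ : List Bx → List Signed → Set where
    ax    : ∀ {Σ S} q → L (var q) ∈ S → R (var q) ∈ S → ⊩ Σ ∣ S
    step  : ∀ {Σ S x bs} → x ∈ S → branches x ≡ just bs →
            (∀ {σ b} → (σ , b) ∈ bs → ⊩ σ ++ Σ ∣ b ++ S) → ⊩ Σ ∣ S
    modal : ∀ {Σ S G β} → R (D G β) ∈ S → ⊩ [] ∣ R β ∷ unbox (members G) Σ → ⊩ Σ ∣ S

  -- The rules inspect a sequent only through membership, so exchange and contraction are covered as
  -- well.
  weaken : ∀ {Σ Σ′ S S′} → Σ ⊑ Σ′ → S ⊑ S′ → ⊩ Σ ∣ S → ⊩ Σ′ ∣ S′
  weaken Σ⊆ S⊆ (ax q l r)     = ax q (S⊆ l) (S⊆ r)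
  weaken Σ⊆ S⊆ (step m eq ds) =
    step (S⊆ m) eq λ {σ} {b} i → weaken (++⁺ʳ σ Σ⊆) (++⁺ʳ b S⊆) (ds i)
  weaken Σ⊆ S⊆ (modal m d)    =
    modal (S⊆ m) (weaken ⊆-refl (∷⁺ʳ _ (unbox-mono Subset.⊆-refl Σ⊆)) d)

  critical≢ : ∀ {x y bs} → branches x ≡ just bs → branches y ≡ nothing → y ≢ x
  critical≢ e e′ refl with () ← ≡.trans (sym e) e′

  -- Induction on the derivation. The inclusion `S ⊑ x ∷ S′` drops all copies of `x` at once and
  -- survives the additions made by other steps. Axioms and modal inferences have critical principal
  -- formulas, hence never `x`.
  invert : ∀ {Σ S S′ x bs σ b} → branches x ≡ just bs → (σ , b) ∈ bs → S ⊑ x ∷ S′ →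
           ⊩ Σ ∣ S → ⊩ σ ++ Σ ∣ b ++ S′
  invert {b = b} e i S⊆ (ax q l r) =
    ax q (∈-++⁺ʳ b (∈-tail (critical≢ e refl) (S⊆ l))) (∈-++⁺ʳ b (∈-tail (critical≢ e refl) (S⊆ r)))
  invert {Σ} {σ = σ} {b} e i S⊆ (modal m d) =
    modal (∈-++⁺ʳ b (∈-tail (critical≢ e refl) (S⊆ m)))
          (weaken ⊆-refl (∷⁺ʳ _ (unbox-mono Subset.⊆-refl (xs⊆ys++xs Σ σ))) d)
  invert {σ = σ} {b} e i S⊆ (step m e′ ds) with S⊆ m
  ... | there m′ = step (∈-++⁺ʳ b m′) e′ λ {τ} {c} j →
        weaken (++-comm-⊑ σ τ) (++-comm-⊑ b c) (invert e i (⊑-under c S⊆) (ds j))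
  -- The last rule decomposes `x` itself: its premise for the chosen branch, once inverted, contains
  -- the additions twice.
  ... | here refl with refl ← ≡.trans (sym e) e′ =
        weaken (++-idem-⊑ σ) (++-idem-⊑ b) (invert e i (⊑-under b S⊆) (ds i))

  -- Measures and induction on sequents

  size : Fm → ℕ
  size (var q)  = 1
  size ⊥ᶠ       = 1
  size (α ∧ᶠ β) = suc (size α + size β)
  size (α ∨ᶠ β) = suc (size α + size β)
  size (α →ᶠ β) = suc (size α + size β)
  size (¬ᶠ α)   = suc (size α)
  size (D G α)  = suc (size α)

  total : List Signed → ℕ
  total S = sum (map (size ∘ form) S)

  private
    one-left : ∀ a b → a + 0 < suc (a + b)
    one-left a b = s≤s (ℕ.+-monoʳ-≤ a z≤n)

    one-right : ∀ a b → b + 0 < suc (a + b)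
    one-right a b rewrite ℕ.+-identityʳ b = s≤s (ℕ.m≤n+m b a)

    both : ∀ a b → a + (b + 0) < suc (a + b)
    both a b rewrite ℕ.+-identityʳ b = ℕ.≤-refl

    single : ∀ a → a + 0 < suc a
    single a rewrite ℕ.+-identityʳ a = ℕ.≤-refl

  branch-smaller : ∀ x {bs σ b} → branches x ≡ just bs → (σ , b) ∈ bs → total b < size (form x)
  branch-smaller (L (var q)) ()
  branch-smaller (L ⊥ᶠ) refl ()
  branch-smaller (L (α ∧ᶠ β)) refl (here refl)         = both (size α) _
  branch-smaller (L (α ∨ᶠ β)) refl (here refl)         = one-left (size α) _
  branch-smaller (L (α ∨ᶠ β)) refl (there (here refl)) = one-right (size α) _
  branch-smaller (L (α →ᶠ β)) refl (here refl)         = one-left (size α) _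
  branch-smaller (L (α →ᶠ β)) refl (there (here refl)) = one-right (size α) _
  branch-smaller (L (¬ᶠ α))   refl (here refl)         = single (size α)
  branch-smaller (L (D G α))  refl (here refl)         = single (size α)
  branch-smaller (R (α ∧ᶠ β)) refl (here refl)         = one-left (size α) _
  branch-smaller (R (α ∧ᶠ β)) refl (there (here refl)) = one-right (size α) _
  branch-smaller (R (α ∨ᶠ β)) refl (here refl)         = both (size α) _
  branch-smaller (R (α →ᶠ β)) refl (here refl)         = both (size α) _
  branch-smaller (R (¬ᶠ α))   refl (here refl)         = single (size α)

  -- Backward search that consumes principal formulas. The measure ignores `Σ`: the T rule moves its
  -- boxed formula there and leaves only the body to be processed.
  module Reduction
    (P : List Bx → List Signed → Set)
    (resp : ∀ {Σ S S′} → S ↭ S′ → P Σ S → P Σ S′)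
    (reduce : ∀ {Σ S x bs} → branches x ≡ just bs →
              (∀ {σ b} → (σ , b) ∈ bs → P (σ ++ Σ) (b ++ S)) → P Σ (x ∷ S))
    (critical : ∀ {Σ S} → All Critical S → P Σ S)
    where

    private
      Below : ℕ → Set
      Below k = ∀ {Σ} todo {done} → total todo < k → All Critical done → P Σ (todo ++ done)

      sweep : ∀ {k} → Below k → Below (suc k)
      sweep below []                    lt       cs = critical cs
      sweep {k} below {Σ} (x ∷ todo) {done} (s≤s le) cs with branches x in e
      ... | nothing = resp (shift x todo done)
              (sweep below todo (s≤s (ℕ.≤-trans (ℕ.m≤n+m _ (size (form x))) le)) (e ∷ cs))
      ... | just bs = reduce e λ {σ} {b} i →
              subst (P (σ ++ Σ)) (List.++-assoc b todo done)
                (below (b ++ todo) (shrink b (branch-smaller x e i)) cs)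
        where
        shrink : ∀ b → total b < size (form x) → total (b ++ todo) < k
        shrink b lt rewrite List.map-++ (size ∘ form) b todo
                          | sum-++ (map (size ∘ form) b) (map (size ∘ form) todo) =
          ℕ.≤-trans (ℕ.+-monoˡ-≤ (total todo) lt) le

      all-below : ∀ k → Below k
      all-below zero    _ ()
      all-below (suc k) = sweep (all-below k)

    reduction-induction : ∀ Σ S → P Σ S
    reduction-induction Σ S = subst (P Σ) (List.++-identityʳ S) (all-below (suc (total S)) S ℕ.≤-refl [])

  depth : Fm → ℕ
  depth (var q)  = 0
  depth ⊥ᶠ       = 0
  depth (α ∧ᶠ β) = depth α ⊔ depth β
  depth (α ∨ᶠ β) = depth α ⊔ depth β
  depth (α →ᶠ β) = depth α ⊔ depth β
  depth (¬ᶠ α)   = depth α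
  depth (D G α)  = suc (depth α)

  record AllIn (Q : Fm → Set) (Σ : List Bx) (S : List Signed) : Set where
    constructor _,_
    field
      in-boxes  : All (Q ∘ uncurry D) Σ
      in-signed : All (Q ∘ form) S

  open AllIn public

  AllIn-++ : ∀ {Q Σ Σ′ S S′} → AllIn Q Σ S → AllIn Q Σ′ S′ → AllIn Q (Σ ++ Σ′) (S ++ S′)
  AllIn-++ (p , q) (p′ , q′) = All.++⁺ p p′ , All.++⁺ q q′

  AllIn-resp : ∀ {Q Σ S S′} → S ↭ S′ → AllIn Q Σ S′ → AllIn Q Σ S
  AllIn-resp π (p , q) = p , All-resp-↭ (↭-sym π) q

  -- Used for depth bounds and for sublanguages, which both have to pass from a sequent to its
  -- branches.
  record SubformulaClosed (Q : Fm → Set) : Set where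
    field
      ∧-parts : ∀ {α β} → Q (α ∧ᶠ β) → Q α × Q β
      ∨-parts : ∀ {α β} → Q (α ∨ᶠ β) → Q α × Q β
      →-parts : ∀ {α β} → Q (α →ᶠ β) → Q α × Q β
      ¬-part  : ∀ {α} → Q (¬ᶠ α) → Q α
      D-part  : ∀ {G α} → Q (D G α) → Q α

    branch-closed : ∀ x {bs σ b} → branches x ≡ just bs → (σ , b) ∈ bs → Q (form x) → AllIn Q σ b
    branch-closed (L (var q))  ()
    branch-closed (L ⊥ᶠ)       refl ()
    branch-closed (L (α ∧ᶠ β)) refl (here refl)         q = [] , proj₁ (∧-parts q) ∷ proj₂ (∧-parts q) ∷ []
    branch-closed (L (α ∨ᶠ β)) refl (here refl)         q = [] , proj₁ (∨-parts q) ∷ []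
    branch-closed (L (α ∨ᶠ β)) refl (there (here refl)) q = [] , proj₂ (∨-parts q) ∷ []
    branch-closed (L (α →ᶠ β)) refl (here refl)         q = [] , proj₁ (→-parts q) ∷ []
    branch-closed (L (α →ᶠ β)) refl (there (here refl)) q = [] , proj₂ (→-parts q) ∷ []
    branch-closed (L (¬ᶠ α))   refl (here refl)         q = [] , ¬-part q ∷ []
    branch-closed (L (D G α))  refl (here refl)         q = q ∷ [] , D-part q ∷ []
    branch-closed (R (α ∧ᶠ β)) refl (here refl)         q = [] , proj₁ (∧-parts q) ∷ []
    branch-closed (R (α ∧ᶠ β)) refl (there (here refl)) q = [] , proj₂ (∧-parts q) ∷ []
    branch-closed (R (α ∨ᶠ β)) refl (here refl)         q = [] , proj₁ (∨-parts q) ∷ proj₂ (∨-parts q) ∷ []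
    branch-closed (R (α →ᶠ β)) refl (here refl)         q = [] , proj₁ (→-parts q) ∷ proj₂ (→-parts q) ∷ []
    branch-closed (R (¬ᶠ α))   refl (here refl)         q = [] , ¬-part q ∷ []

    branches-closed : ∀ {x bs σ b Σ S} → branches x ≡ just bs → (σ , b) ∈ bs →
                      AllIn Q Σ (x ∷ S) → AllIn Q (σ ++ Σ) (b ++ S)
    branches-closed {x} e i (p , q ∷ qs) = AllIn-++ (branch-closed x e i q) (p , qs)

  depth-closed : ∀ k → SubformulaClosed λ α → depth α < k
  depth-closed k = record
    { ∧-parts = parts ; ∨-parts = parts ; →-parts = parts
    ; ¬-part  = λ lt → lt
    ; D-part  = ℕ.<-trans (ℕ.n<1+n _)
    }
    where
    parts : ∀ {a b} → a ⊔ b < k → a < k × b < k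
    parts {a} {b} lt = ℕ.m⊔n<o⇒m<o a b lt , ℕ.m⊔n<o⇒n<o a b lt

  -- Outer induction on a strict bound for the modal depth, inner one by `Reduction`: copying
  -- `D G α` into `Σ` respects the bound, unboxing lowers it. `critical` receives `P` for every `Z`
  -- because the group of a modal inference may come from outside the sequent.
  module SequentInduction
    (P : List Bx → List Signed → Set)
    (resp : ∀ {Σ S S′} → S ↭ S′ → P Σ S → P Σ S′)
    (empty : P [] [])
    (reduce : ∀ {Σ S x bs} → branches x ≡ just bs →
              (∀ {σ b} → (σ , b) ∈ bs → P (σ ++ Σ) (b ++ S)) → P Σ (x ∷ S))
    (critical : ∀ {Σ S} → All Critical S →
                (∀ {G β} → R (D G β) ∈ S → P [] (R β ∷ unbox (members G) Σ)) →
                (∀ Z → P [] (unbox Z Σ)) →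
                P Σ S)
    where

    private
      level : ∀ k Σ S → AllIn (λ α → depth α < k) Σ S → P Σ S
      level zero    []      []      _             = empty
      level zero    (B ∷ Σ) S       (() ∷ _ , _)
      level zero    []      (x ∷ S) (_ , () ∷ _)
      level (suc k) = Reduction.reduction-induction
          (λ Σ S → AllIn (λ α → depth α < suc k) Σ S → P Σ S)
          (λ π f h → resp π (f (AllIn-resp π h)))
          (λ e f h → reduce e λ i → f i (branches-closed e i h))
          (λ {Σ} cs h → critical cs
            (λ m → level k _ _ ([] , ℕ.≤-pred (All.lookup (in-signed h) m) ∷ unbox-shallow Σ (in-boxes h)))
            (λ Z → level k _ _ ([] , unbox-shallow Σ (in-boxes h))))
        where
        open SubformulaClosed (depth-closed (suc k))

        unbox-shallow : ∀ {Z} Σ → All (λ B → depth (uncurry D B) < suc k) Σ →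
                        All (λ x → depth (form x) < k) (unbox Z Σ)
        unbox-shallow Σ p = All-unbox Σ λ i → ℕ.≤-pred (All.lookup p i)

    sequent-induction : ∀ Σ S → P Σ S
    sequent-induction Σ S with k , p ← bounded (depth ∘ uncurry D) Σ | l , q ← bounded (depth ∘ form) S =
      level (k ⊔ l) Σ S
        ( All.map (λ lt → ℕ.≤-trans lt (ℕ.m≤m⊔n k l)) p
        , All.map (λ lt → ℕ.≤-trans lt (ℕ.m≤n⊔m k l)) q )

  -- Equivalence of the two calculi

  -- Asking only that `S` contain both sides builds weakening into the induction, so the principal
  -- formulas that stay in `S` do no harm.
  embed : ∀ {Σ Γ Δ} → ⊢ Σ ∣ Γ ⇒ Δ → ∀ {S} → Every (λ α → L α ∈ S) Γ → Every (λ α → R α ∈ S) Δ → ⊩ Σ ∣ S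
  embed (≋ πΣ πΓ πΔ d) l r =
    weaken (⊆-reflexive-↭ πΣ) ⊆-refl (embed d (l ∘ ∈-resp-↭ πΓ) (r ∘ ∈-resp-↭ πΔ))
  embed (ax q) l r = ax q (l (here refl)) (r (here refl))
  embed L⊥ l r = step (l (here refl)) refl λ ()
  embed (R∧ d e) l r = step (r (here refl)) refl λ where
    (here refl)         → embed d (there ∘ l) (Every-∷ (here refl) (there ∘ r ∘ there))
    (there (here refl)) → embed e (there ∘ l) (Every-∷ (here refl) (there ∘ r ∘ there))
  embed (L∧ d) l r = step (l (here refl)) refl λ where
    (here refl) → embed d
      (Every-∷ (here refl) (Every-∷ (there (here refl)) (there ∘ there ∘ l ∘ there)))
      (there ∘ there ∘ r)
  embed (R∨ d) l r = step (r (here refl)) refl λ where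
    (here refl) → embed d
      (there ∘ there ∘ l)
      (Every-∷ (here refl) (Every-∷ (there (here refl)) (there ∘ there ∘ r ∘ there)))
  embed (L∨ d e) l r = step (l (here refl)) refl λ where
    (here refl)         → embed d (Every-∷ (here refl) (there ∘ l ∘ there)) (there ∘ r)
    (there (here refl)) → embed e (Every-∷ (here refl) (there ∘ l ∘ there)) (there ∘ r)
  embed (R→ d) l r = step (r (here refl)) refl λ where
    (here refl) → embed d
      (Every-∷ (here refl) (there ∘ there ∘ l))
      (Every-∷ (there (here refl)) (there ∘ there ∘ r ∘ there))
  embed (L→ d e) l r = step (l (here refl)) refl λ where
    (here refl)         → embed d (there ∘ l ∘ there) (Every-∷ (here refl) (there ∘ r))
    (there (here refl)) → embed e (Every-∷ (here refl) (there ∘ l ∘ there)) (there ∘ r)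
  embed (R¬ d) l r = step (r (here refl)) refl λ where
    (here refl) → embed d (Every-∷ (here refl) (there ∘ l)) (there ∘ r ∘ there)
  embed (L¬ d) l r = step (l (here refl)) refl λ where
    (here refl) → embed d (there ∘ l ∘ there) (Every-∷ (here refl) (there ∘ r))
  embed (DK⁺ {Σ} {Ξ} Ξ⊆ _ _ _ d) l r = modal (r (here refl)) (embed d unboxed λ where (here refl) → here refl)
    where
    unboxed : Every (λ α → L α ∈ _ ∷ unbox _ (Σ ++ Ξ)) (map proj₂ Ξ)
    unboxed m with _ , i , refl ← ∈-map⁻ proj₂ m = there (∈-unbox⁺ (∈-++⁺ʳ Σ i) (All.lookup Ξ⊆ i))
  embed (DT⁺ d) l r = step (l (here refl)) refl λ where
    (here refl) → embed d (Every-∷ (here refl) (there ∘ l ∘ there)) (there ∘ r)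

  lefts rights : List Signed → List Fm
  lefts []         = []
  lefts (L α ∷ S)  = α ∷ lefts S
  lefts (R α ∷ S)  = lefts S
  rights []        = []
  rights (L α ∷ S) = rights S
  rights (R α ∷ S) = α ∷ rights S

  lefts-↭ : ∀ {S S′} → S ↭ S′ → lefts S ↭ lefts S′
  lefts-↭ refl = refl
  lefts-↭ (prep (L α) π) = prep α (lefts-↭ π)
  lefts-↭ (prep (R α) π) = lefts-↭ π
  lefts-↭ (swap (L α) (L β) π) = swap α β (lefts-↭ π)
  lefts-↭ (swap (L α) (R β) π) = prep α (lefts-↭ π)
  lefts-↭ (swap (R α) (L β) π) = prep β (lefts-↭ π)
  lefts-↭ (swap (R α) (R β) π) = lefts-↭ π
  lefts-↭ (trans π ρ) = trans (lefts-↭ π) (lefts-↭ ρ)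

  rights-↭ : ∀ {S S′} → S ↭ S′ → rights S ↭ rights S′
  rights-↭ refl = refl
  rights-↭ (prep (L α) π) = rights-↭ π
  rights-↭ (prep (R α) π) = prep α (rights-↭ π)
  rights-↭ (swap (L α) (L β) π) = rights-↭ π
  rights-↭ (swap (L α) (R β) π) = prep β (rights-↭ π)
  rights-↭ (swap (R α) (L β) π) = prep α (rights-↭ π)
  rights-↭ (swap (R α) (R β) π) = swap α β (rights-↭ π)
  rights-↭ (trans π ρ) = trans (rights-↭ π) (rights-↭ ρ)

  infix 3 ⊢ˢ_∣_

  ⊢ˢ_∣_ : List Bx → List Signed → Set
  ⊢ˢ Σ ∣ S = ⊢ Σ ∣ lefts S ⇒ rights S

  ⊢ˢ-resp : ∀ {Σ S S′} → S ↭ S′ → ⊢ˢ Σ ∣ S → ⊢ˢ Σ ∣ S′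
  ⊢ˢ-resp π = ≋ ↭-refl (lefts-↭ π) (rights-↭ π)

  ⊢ˢ-step : ∀ x {Σ S bs} → branches x ≡ just bs →
            (∀ {σ b} → (σ , b) ∈ bs → ⊢ˢ σ ++ Σ ∣ b ++ S) → ⊢ˢ Σ ∣ x ∷ S
  ⊢ˢ-step (L ⊥ᶠ)       refl ds = L⊥
  ⊢ˢ-step (L (α ∧ᶠ β)) refl ds = L∧ (ds (here refl))
  ⊢ˢ-step (L (α ∨ᶠ β)) refl ds = L∨ (ds (here refl)) (ds (there (here refl)))
  ⊢ˢ-step (L (α →ᶠ β)) refl ds = L→ (ds (here refl)) (ds (there (here refl)))
  ⊢ˢ-step (L (¬ᶠ α))   refl ds = L¬ (ds (here refl))
  ⊢ˢ-step (L (D G α))  refl ds = DT⁺ (ds (here refl))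
  ⊢ˢ-step (R (α ∧ᶠ β)) refl ds = R∧ (ds (here refl)) (ds (there (here refl)))
  ⊢ˢ-step (R (α ∨ᶠ β)) refl ds = R∨ (ds (here refl))
  ⊢ˢ-step (R (α →ᶠ β)) refl ds = R→ (ds (here refl))
  ⊢ˢ-step (R (¬ᶠ α))   refl ds = R¬ (ds (here refl))

  lefts-atomic : ∀ {S} → All Critical S → All Atomic (lefts S)
  lefts-atomic [] = []
  lefts-atomic {L (var q) ∷ S} (c ∷ cs) = atom-var q ∷ lefts-atomic cs
  lefts-atomic {R α ∷ S}       (c ∷ cs) = lefts-atomic cs

  rights-critical : ∀ {S} → All Critical S → All (Atomic ∪ OutmostBoxed) (rights S)
  rights-critical [] = []
  rights-critical {L α ∷ S}       (c ∷ cs) = rights-critical cs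
  rights-critical {R (var q) ∷ S} (c ∷ cs) = inj₁ (atom-var q) ∷ rights-critical cs
  rights-critical {R ⊥ᶠ ∷ S}      (c ∷ cs) = inj₁ atom-⊥ ∷ rights-critical cs
  rights-critical {R (D G β) ∷ S} (c ∷ cs) = inj₂ (boxed G β) ∷ rights-critical cs

  outer : Subset n → List Bx → List Bx
  outer Z = filter (λ B → ¬? (B within? Z))

  partition-↭ : ∀ Z Σ → outer Z Σ ++ filter (_within? Z) Σ ↭ Σ
  partition-↭ Z [] = refl
  partition-↭ Z (B ∷ Σ) with B within? Z
  ... | yes _ = trans (shift B (outer Z Σ) _) (prep B (partition-↭ Z Σ))
  ... | no  _ = prep B (partition-↭ Z Σ)

  lefts-unbox : ∀ (Ξ : List Bx) → lefts (map body Ξ) ≡ map proj₂ Ξ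
  lefts-unbox [] = refl
  lefts-unbox (B ∷ Ξ) = cong (_ ∷_) (lefts-unbox Ξ)

  rights-unbox : ∀ (Ξ : List Bx) → rights (map body Ξ) ≡ []
  rights-unbox [] = refl
  rights-unbox (B ∷ Ξ) = rights-unbox Ξ

  -- Splitting `Σ` by inclusion in `G` gives the two box lists of `DK⁺`; criticality of the rest of
  -- `S` gives the other side conditions.
  ⊢ˢ-critical : ∀ {Σ S G β} → All Critical S → R (D G β) ∈ S →
                ⊢ˢ [] ∣ R β ∷ unbox (members G) Σ → ⊢ˢ Σ ∣ S
  ⊢ˢ-critical {Σ} {S} {G} {β} cs m d
    with S′ , π ← extract m
    with c ∷ cs′ ← All-resp-↭ π cs =
    ⊢ˢ-resp (↭-sym π) (≋ (partition-↭ (members G) Σ) refl refl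
      (DK⁺ (All.all-filter (_within? members G) Σ) (All.all-filter _ Σ)
           (lefts-atomic cs′) (rights-critical cs′) premise))
    where
    premise : ⊢ [] ∣ map proj₂ (filter (_within? members G) Σ) ⇒ [ β ]
    premise = ≋ refl (↭-reflexive (lefts-unbox _))
      (↭-reflexive (cong (β ∷_) (rights-unbox (filter (_within? members G) Σ)))) d

  -- The rest of `S` is decomposed until it is critical; the boxed formula survives, being critical
  -- itself. The T rule enlarges `Σ` on the way, hence the premise for every larger `Σ′`.
  ⊢ˢ-modal : ∀ {G β} Σ S → R (D G β) ∈ S →
             (∀ {Σ′} → Σ ⊑ Σ′ → ⊢ˢ [] ∣ R β ∷ unbox (members G) Σ′) → ⊢ˢ Σ ∣ S
  ⊢ˢ-modal {G} {β} = Reduction.reduction-induction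
      (λ Σ S → R (D G β) ∈ S → (∀ {Σ′} → Σ ⊑ Σ′ → ⊢ˢ [] ∣ R β ∷ unbox (members G) Σ′) → ⊢ˢ Σ ∣ S)
      (λ π f m g → ⊢ˢ-resp π (f (∈-resp-↭ (↭-sym π) m) g))
      (λ e f m g → ⊢ˢ-step _ e λ {σ} {b} i →
        f i (∈-++⁺ʳ b (∈-tail (critical≢ e refl) m)) λ ⊆Σ′ → g (⊆-trans (xs⊆ys++xs _ σ) ⊆Σ′))
      (λ cs m g → ⊢ˢ-critical cs m (g ⊆-refl))

  -- The invariant that turns a cumulative derivation into one that consumes principal formulas:
  -- a formula of the cumulative sequent may be missing from the target once a branch is present.
  data Realised (Σ : List Bx) (S : List Signed) : Signed → Set where
    member : ∀ {x} → x ∈ S → Realised Σ S x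
    branch : ∀ {x bs σ b} → branches x ≡ just bs → (σ , b) ∈ bs → σ ⊑ Σ →
             (∀ {y} → y ∈ b → Realised Σ S y) → Realised Σ S x

  Realised-mono : ∀ {Σ Σ′ S S′} → Σ ⊑ Σ′ → (∀ {x} → x ∈ S → Realised Σ′ S′ x) →
                  ∀ {x} → Realised Σ S x → Realised Σ′ S′ x
  Realised-mono Σ⊆ f (member m)       = f m
  Realised-mono Σ⊆ f (branch e i s g) = branch e i (Σ⊆ ∘ s) λ m → Realised-mono Σ⊆ f (g m)

  realised-critical : ∀ {Σ S x} → Critical x → Realised Σ S x → x ∈ S
  realised-critical c (member m)       = m
  realised-critical c (branch e _ _ _) = contradiction refl (critical≢ e c)

  -- Contraction is absorbed here: decomposing a kept formula a second time costs no rule in the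
  -- target, since `Realised` records the branch taken.
  ⊩⇒⊢ˢ : ∀ {Σ S} → ⊩ Σ ∣ S → ∀ {Σ′ S′} → Σ ⊑ Σ′ → (∀ {x} → x ∈ S → Realised Σ′ S′ x) → ⊢ˢ Σ′ ∣ S′
  ⊩⇒⊢ˢ (ax q l r) {Σ′} {S′} Σ⊆ f
    with S₁ , π ← extract (realised-critical refl (f l))
    with S₂ , ρ ← extract (∈-tail (λ ()) (∈-resp-↭ π (realised-critical refl (f r)))) =
    ⊢ˢ-resp (↭-sym (trans π (prep _ ρ))) (ax q)
  ⊩⇒⊢ˢ (step {x = x} m e ds) {Σ′} {S′} Σ⊆ f with f m
  -- Already decomposed: the premise of the recorded branch serves with the target unchanged.
  ... | branch e′ i s g with refl ← ≡.trans (sym e) e′ =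
        ⊩⇒⊢ˢ (ds i) (Every-++ _ s Σ⊆) (Every-++ _ g f)
  -- Still present: the rule consumes this copy of `x`, which each premise then realises through its
  -- branch.
  ... | member k with S₁ , π ← extract k =
        ⊢ˢ-resp (↭-sym π) (⊢ˢ-step x e λ {σ} {b} i →
          ⊩⇒⊢ˢ (ds i) (++⁺ʳ σ Σ⊆) (Every-++ b (member ∘ ∈-++⁺ˡ)
            (Realised-mono (xs⊆ys++xs _ σ) (decomposed i) ∘ f)))
    where
    decomposed : ∀ {σ b} → (σ , b) ∈ _ → ∀ {y} → y ∈ S′ → Realised (σ ++ Σ′) (b ++ S₁) y
    decomposed {b = b} i k′ with ∈-resp-↭ π k′
    ... | here refl = branch e i ∈-++⁺ˡ (member ∘ ∈-++⁺ˡ)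
    ... | there k″  = member (∈-++⁺ʳ b k″)
  -- Only unboxed bodies and `β` pass to the premise, so the invariant restarts with plain
  -- membership.
  ⊩⇒⊢ˢ (modal m d) Σ⊆ f =
    ⊢ˢ-modal _ _ (realised-critical refl (f m)) λ ⊆Σ″ →
      ⊩⇒⊢ˢ d (λ ()) λ k → member (∷⁺ʳ _ (unbox-mono Subset.⊆-refl (⊆Σ″ ∘ Σ⊆)) k)

  data CriticalView : Signed → Set where
    left-var  : ∀ q → CriticalView (L (var q))
    right-var : ∀ q → CriticalView (R (var q))
    right-⊥   : CriticalView (R ⊥ᶠ)
    right-box : ∀ G β → CriticalView (R (D G β))

  view : ∀ {x} → Critical x → CriticalView x
  view {L (var q)} c = left-var q
  view {R (var q)} c = right-var q
  view {R ⊥ᶠ}      c = right-⊥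
  view {R (D G β)} c = right-box G β

  -- Decidability of the cumulative calculus

  module Decidability (_≟_ : DecidableEquality Var) where

    -- A derivation of a critical sequent ends in an axiom or a modal inference; each is charged to
    -- its right formula, so the search runs over the members of `S`.
    data Closes (Σ : List Bx) (S : List Signed) : Signed → Set where
      by-ax    : ∀ {q} → L (var q) ∈ S → Closes Σ S (R (var q))
      by-modal : ∀ {G β} → ⊩ [] ∣ R β ∷ unbox (members G) Σ → Closes Σ S (R (D G β))

    closed⇒⊩ : ∀ {Σ S} → ∃[ x ] x ∈ S × Closes Σ S x → ⊩ Σ ∣ S
    closed⇒⊩ (_ , m , by-ax l)    = ax _ l m
    closed⇒⊩ (_ , m , by-modal d) = modal m d

    ⊩⇒closed : ∀ {Σ S} → All Critical S → ⊩ Σ ∣ S → ∃[ x ] x ∈ S × Closes Σ S x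
    ⊩⇒closed cs (ax q l r)    = _ , r , by-ax l
    ⊩⇒closed cs (step m e _)  = contradiction refl (critical≢ e (All.lookup cs m))
    ⊩⇒closed cs (modal m d)   = _ , m , by-modal d

    left-var? : ∀ {S} → All Critical S → ∀ q → Dec (L (var q) ∈ S)
    left-var? {S} cs q = map′ (λ { (_ , m , refl) → m }) (λ m → _ , m , refl)
      (any-member? S λ m → equals (view (All.lookup cs m)))
      where
      equals : ∀ {x} → CriticalView x → Dec (x ≡ L (var q))
      equals (left-var r)    = map′ (cong (L ∘ var)) (λ { refl → refl }) (r ≟ q)
      equals (right-var _)   = no λ ()
      equals right-⊥         = no λ ()
      equals (right-box _ _) = no λ ()

    -- By inversion a sequent is derivable exactly when all premises of a decomposition are, and a
    -- critical one exactly when some member closes it.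
    ⊩? : ∀ Σ S → Dec (⊩ Σ ∣ S)
    ⊩? = SequentInduction.sequent-induction
        (λ Σ S → Dec (⊩ Σ ∣ S))
        (λ π → map′ (weaken ⊆-refl (⊆-reflexive-↭ π)) (weaken ⊆-refl (⊆-reflexive-↭ (↭-sym π))))
        (no λ d → case ⊩⇒closed [] d of λ { (_ , () , _) })
        (λ {Σ} {S} {x} {bs} e d? → map′
          (λ ds → step (here refl) e λ {σ} {b} i → weaken ⊆-refl (++⁺ʳ b there) (All.lookup ds i))
          (λ d → All.tabulate λ i → invert e i ⊆-refl d)
          (all-members? {Q = uncurry λ σ b → ⊩ σ ++ Σ ∣ b ++ S} bs d?))
        (λ {Σ} {S} cs d? _ → map′ closed⇒⊩ (⊩⇒closed cs)
          (any-member? S λ m → closes? cs (view (All.lookup cs m)) λ { refl → d? m }))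
      where
      closes? : ∀ {Σ S x} → All Critical S → CriticalView x →
                (∀ {G β} → x ≡ R (D G β) → Dec (⊩ [] ∣ R β ∷ unbox (members G) Σ)) → Dec (Closes Σ S x)
      closes? cs (left-var q)    d? = no λ ()
      closes? cs (right-var q)   d? = map′ by-ax (λ { (by-ax l) → l }) (left-var? cs q)
      closes? cs right-⊥         d? = no λ ()
      closes? cs (right-box G β) d? = map′ by-modal (λ { (by-modal d) → d }) (d? refl)

  -- Sublanguages and the agents of boxed formulas

  -- Recursive form of the inclusions of variables in `X` and agents in `Y`; the parts of a compound
  -- formula then inherit it by projection.
  Lang : Pred Var 0ℓ → Pred (Fin n) 0ℓ → Fm → Set
  Lang X Y (var q)  = X q
  Lang X Y ⊥ᶠ       = ⊤
  Lang X Y (α ∧ᶠ β) = Lang X Y α × Lang X Y β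
  Lang X Y (α ∨ᶠ β) = Lang X Y α × Lang X Y β
  Lang X Y (α →ᶠ β) = Lang X Y α × Lang X Y β
  Lang X Y (¬ᶠ α)   = Lang X Y α
  Lang X Y (D G α)  = (∀ {b} → b Subset.∈ members G → Y b) × Lang X Y α

  Lang-closed : ∀ {X Y} → SubformulaClosed (Lang X Y)
  Lang-closed = record
    { ∧-parts = λ l → l ; ∨-parts = λ l → l ; →-parts = λ l → l ; ¬-part = λ l → l ; D-part = proj₂ }

  Lang-unbox : ∀ {X Y Z} Σ → All (Lang X Y ∘ uncurry D) Σ → All (Lang X Y ∘ form) (unbox Z Σ)
  Lang-unbox Σ p = All-unbox Σ λ i → proj₂ (All.lookup p i)

  Lang⇒V⊆ : ∀ {X Y} α → Lang X Y α → ∀ {q} → V α q → X q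
  Lang⇒V⊆ (var q)  l         refl     = l
  Lang⇒V⊆ (α ∧ᶠ β) (l , l′) (inj₁ v) = Lang⇒V⊆ α l v
  Lang⇒V⊆ (α ∧ᶠ β) (l , l′) (inj₂ v) = Lang⇒V⊆ β l′ v
  Lang⇒V⊆ (α ∨ᶠ β) (l , l′) (inj₁ v) = Lang⇒V⊆ α l v
  Lang⇒V⊆ (α ∨ᶠ β) (l , l′) (inj₂ v) = Lang⇒V⊆ β l′ v
  Lang⇒V⊆ (α →ᶠ β) (l , l′) (inj₁ v) = Lang⇒V⊆ α l v
  Lang⇒V⊆ (α →ᶠ β) (l , l′) (inj₂ v) = Lang⇒V⊆ β l′ v
  Lang⇒V⊆ (¬ᶠ α)   l         v        = Lang⇒V⊆ α l v
  Lang⇒V⊆ (D G α)  (_ , l)  v        = Lang⇒V⊆ α l v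

  Lang⇒Agt⊆ : ∀ {X Y} α → Lang X Y α → ∀ {b} → Agt α b → Y b
  Lang⇒Agt⊆ (α ∧ᶠ β) (l , l′) (inj₁ v) = Lang⇒Agt⊆ α l v
  Lang⇒Agt⊆ (α ∧ᶠ β) (l , l′) (inj₂ v) = Lang⇒Agt⊆ β l′ v
  Lang⇒Agt⊆ (α ∨ᶠ β) (l , l′) (inj₁ v) = Lang⇒Agt⊆ α l v
  Lang⇒Agt⊆ (α ∨ᶠ β) (l , l′) (inj₂ v) = Lang⇒Agt⊆ β l′ v
  Lang⇒Agt⊆ (α →ᶠ β) (l , l′) (inj₁ v) = Lang⇒Agt⊆ α l v
  Lang⇒Agt⊆ (α →ᶠ β) (l , l′) (inj₂ v) = Lang⇒Agt⊆ β l′ v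
  Lang⇒Agt⊆ (¬ᶠ α)   l         v        = Lang⇒Agt⊆ α l v
  Lang⇒Agt⊆ (D G α)  (g , l)  (inj₁ v) = g v
  Lang⇒Agt⊆ (D G α)  (g , l)  (inj₂ v) = Lang⇒Agt⊆ α l v

  ⊆⇒Lang : ∀ {X Y} α → (∀ {q} → V α q → X q) → (∀ {b} → Agt α b → Y b) → Lang X Y α
  ⊆⇒Lang (var q)  v g = v refl
  ⊆⇒Lang ⊥ᶠ       v g = tt
  ⊆⇒Lang (α ∧ᶠ β) v g = ⊆⇒Lang α (v ∘ inj₁) (g ∘ inj₁) , ⊆⇒Lang β (v ∘ inj₂) (g ∘ inj₂)
  ⊆⇒Lang (α ∨ᶠ β) v g = ⊆⇒Lang α (v ∘ inj₁) (g ∘ inj₁) , ⊆⇒Lang β (v ∘ inj₂) (g ∘ inj₂)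
  ⊆⇒Lang (α →ᶠ β) v g = ⊆⇒Lang α (v ∘ inj₁) (g ∘ inj₁) , ⊆⇒Lang β (v ∘ inj₂) (g ∘ inj₂)
  ⊆⇒Lang (¬ᶠ α)   v g = ⊆⇒Lang α v g
  ⊆⇒Lang (D G α)  v g = g ∘ inj₁ , ⊆⇒Lang α v (g ∘ inj₂)

  agents : List Bx → Subset n
  agents Σ = ⋃ (map (members ∘ proj₁) Σ)

  members⊆agents : ∀ {Σ B} → B ∈ Σ → members (proj₁ B) Subset.⊆ agents Σ
  members⊆agents (here refl) x∈ = Subset.x∈p∪q⁺ (inj₁ x∈)
  members⊆agents (there m)   x∈ = Subset.x∈p∪q⁺ (inj₂ (members⊆agents m x∈))

  ∈-agents⁻ : ∀ Σ {x} → x Subset.∈ agents Σ → ∃[ B ] B ∈ Σ × x Subset.∈ members (proj₁ B)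
  ∈-agents⁻ []      x∈ = contradiction x∈ Subset.∉⊥
  ∈-agents⁻ (B ∷ Σ) x∈ with Subset.x∈p∪q⁻ (members (proj₁ B)) (agents Σ) x∈
  ... | inj₁ x∈B = B , here refl , x∈B
  ... | inj₂ x∈Σ with C , m , x∈C ← ∈-agents⁻ Σ x∈Σ = C , there m , x∈C

  -- Groups are nonempty, so none fits into an empty set. The nonemptiness proof is irrelevant,
  -- hence the irrelevant elimination.
  unbox-empty : ∀ {Z} Σ → ¬ Nonempty Z → unbox Z Σ ⊑ []
  unbox-empty Σ ¬ne m with mkGrp H ne , _ , _ , H⊆Z , _ ← ∈-unbox⁻ Σ m =
    ⊥-elim-irr (¬ne (proj₁ ne , H⊆Z (proj₂ ne)))

  -- Finite conjunctions

  ⊤ᶠ : Fm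
  ⊤ᶠ = ¬ᶠ ⊥ᶠ

  -- The family depends on membership proofs because an interpolant is available only for a branch
  -- known to occur in the list.
  ⋀ : ∀ {I : Set} (is : List I) → (∀ {i} → i ∈ is → Fm) → Fm
  ⋀ []       F = ⊤ᶠ
  ⋀ (i ∷ is) F = F (here refl) ∧ᶠ ⋀ is (F ∘ there)

  ⋀-Lang : ∀ {I : Set} {X Y} (is : List I) (F : ∀ {i} → i ∈ is → Fm) →
           (∀ {i} (m : i ∈ is) → Lang X Y (F m)) → Lang X Y (⋀ is F)
  ⋀-Lang []       F l = tt
  ⋀-Lang (i ∷ is) F l = l (here refl) , ⋀-Lang is (F ∘ there) (l ∘ there)

  ⋀-left : ∀ {I : Set} {Σ S} (is : List I) (F : ∀ {i} → i ∈ is → Fm) {i} (m : i ∈ is) →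
           ⊩ Σ ∣ L (F m) ∷ S → ⊩ Σ ∣ L (⋀ is F) ∷ S
  ⋀-left (i ∷ is) F (here refl) d = step (here refl) refl λ where
    (here refl) → weaken ⊆-refl (∷⁺ʳ _ (there ∘ there)) d
  ⋀-left (i ∷ is) F (there m)   d = step (here refl) refl λ where
    (here refl) → weaken ⊆-refl (∈-∷⁺ʳ (there (here refl)) (there ∘ there ∘ there)) (⋀-left is (F ∘ there) m d)

  ⋀-right : ∀ {I : Set} {Σ S} (is : List I) (F : ∀ {i} → i ∈ is → Fm) →
            (∀ {i} (m : i ∈ is) → ⊩ Σ ∣ R (F m) ∷ S) → ⊩ Σ ∣ R (⋀ is F) ∷ S
  ⋀-right []       F ds = step (here refl) refl λ where
    (here refl) → step (here refl) refl λ ()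
  ⋀-right (i ∷ is) F ds = step (here refl) refl λ where
    (here refl)         → weaken ⊆-refl (∷⁺ʳ _ there) (ds (here refl))
    (there (here refl)) → weaken ⊆-refl (∷⁺ʳ _ there) (⋀-right is (F ∘ there) (ds ∘ there))

  -- Construction of the interpolants

  module Interpolation (_≟_ : DecidableEquality Var) (p : Var) (a : Fin n)
                       (X : Pred Var 0ℓ) (Y : Pred (Fin n) 0ℓ) where

    open Decidability _≟_
    module Closed {X Y} = SubformulaClosed (Lang-closed {X} {Y})

    -- The language of the contexts in clause (iii).
    Free : Fm → Set
    Free = Lang (p ≢_) (a ≢_)

    _⊖a : Subset n → Subset n
    Z ⊖a = Z ∩ ∁ ⁅ a ⁆

    ∈-⊖⁺ : ∀ {Z x} → x Subset.∈ Z → a ≢ x → x Subset.∈ Z ⊖a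
    ∈-⊖⁺ x∈Z a≢x = Subset.x∈p∩q⁺ (x∈Z , Subset.x∉p⇒x∈∁p (a≢x ∘ sym ∘ Subset.x∈⁅y⁆⇒x≡y _))

    ∈-⊖⁻ : ∀ Z {x} → x Subset.∈ Z ⊖a → x Subset.∈ Z × a ≢ x
    ∈-⊖⁻ Z x∈ with x∈Z , x∈∁ ← Subset.x∈p∩q⁻ Z _ x∈ =
      x∈Z , λ { refl → Subset.x∈∁p⇒x∉p x∈∁ (Subset.x∈⁅x⁆ a) }

    -- An interpolant serves all contexts Θ ∣ U that complete Σ ∣ S to a derivable sequent; a
    -- disjunct of it need only serve those in which one particular last inference is possible.
    record Partial (Σ : List Bx) (S : List Signed) (Q : List Bx → List Signed → Set) : Set where
      field
        formula  : Fm
        language : Lang (X ∖ ｛ p ｝) (Y ∖ ｛ a ｝) formula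
        left     : ⊩ Σ ∣ L formula ∷ S
        right    : ∀ {Θ U} → AllIn Free Θ U → Q Θ U → ⊩ Θ ∣ R formula ∷ U

    open Partial

    Interpolant : List Bx → List Signed → Set
    Interpolant Σ S = Partial Σ S λ Θ U → ⊩ Θ ++ Σ ∣ U ++ S

    top : ∀ {Σ S Q} → ⊩ Σ ∣ S → Partial Σ S Q
    top d = record
      { formula  = ⊤ᶠ
      ; language = tt
      ; left     = weaken ⊆-refl there d
      ; right    = λ _ _ → step (here refl) refl λ where
          (here refl) → step (here refl) refl λ ()
      }

    bottom : ∀ {Σ S Q} → (∀ {Θ U} → AllIn Free Θ U → Q Θ U → ⊩ Θ ∣ U) → Partial Σ S Q
    bottom f = record
      { formula  = ⊥ᶠ
      ; language = tt
      ; left     = step (here refl) refl λ ()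
      ; right    = λ h q → weaken ⊆-refl there (f h q)
      }

    either : ∀ {Σ S Q Q′} → Partial Σ S Q → Partial Σ S Q′ → Partial Σ S (λ Θ U → Q Θ U ⊎ Q′ Θ U)
    either A B = record
      { formula  = formula A ∨ᶠ formula B
      ; language = language A , language B
      ; left     = step (here refl) refl λ where
          (here refl)         → weaken ⊆-refl (∷⁺ʳ _ there) (left A)
          (there (here refl)) → weaken ⊆-refl (∷⁺ʳ _ there) (left B)
      ; right    = λ where
          h (inj₁ q) → step (here refl) refl λ where
            (here refl) → weaken ⊆-refl (∷⁺ʳ _ (there ∘ there)) (right A h q)
          h (inj₂ q) → step (here refl) refl λ where
            (here refl) → weaken ⊆-refl (∈-∷⁺ʳ (there (here refl)) (there ∘ there ∘ there)) (right B h q)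
      }

    some : ∀ {Σ S} {I : Set} {Q : I → List Bx → List Signed → Set} is →
           (∀ {i} → i ∈ is → Partial Σ S (Q i)) → Partial Σ S (λ Θ U → ∃[ i ] i ∈ is × Q i Θ U)
    some []       f = bottom λ { _ (_ , () , _) }
    some (i ∷ is) f = record
      { formula  = formula A
      ; language = language A
      ; left     = left A
      ; right    = λ where
          h (_ , here refl , q) → right A h (inj₁ q)
          h (j , there m , q)   → right A h (inj₂ (j , m , q))
      }
      where A = either (f (here refl)) (some is (f ∘ there))

    -- The rule for `x` gives `left`, each branch using its own conjunct; inversion of `x` gives
    -- `right`. For `⊥ᶠ` on the left the conjunction is empty.
    reduce : ∀ {Σ S x bs} → branches x ≡ just bs →
             (∀ {σ b} → (σ , b) ∈ bs → Interpolant (σ ++ Σ) (b ++ S)) → Interpolant Σ (x ∷ S)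
    reduce {Σ} {S} {x} {bs} e A = record
      { formula  = ⋀ bs F
      ; language = ⋀-Lang bs F (language ∘ A)
      ; left     = step (there (here refl)) e λ {σ} {b} i →
          weaken ⊆-refl
            (∈-∷⁺ʳ (∈-++⁺ʳ b (here refl)) (++⁺ʳ b (there ∘ there)))
            (⋀-left bs F i (left (A i)))
      ; right    = λ {Θ} {U} h d → ⋀-right bs F λ {(σ , b)} i →
          right (A i) h (weaken (++-comm-⊑ σ Θ) (++-comm-⊑ b U)
            (invert e i (⊆-reflexive-↭ (shift x U S)) d))
      }
      where
      F : ∀ {B} → B ∈ bs → Fm
      F i = formula (A i)

    -- The last inference uses the given formula of `S`: an axiom pairs it with a formula of the
    -- context, or it is principal in a modal inference.
    Meets : List Bx → Signed → List Bx → List Signed → Set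
    Meets Σ (L (var q))  Θ U = R (var q) ∈ U
    Meets Σ (R (var q))  Θ U = L (var q) ∈ U
    Meets Σ (R (D G β))  Θ U = ⊩ [] ∣ R β ∷ unbox (members G) (Θ ++ Σ)
    Meets Σ _            Θ U = ⊥

    -- Groups of a free context avoid `a`, so deleting `a` from the bound excludes none of them.
    free⊆⊖ : ∀ {Θ U Z} → AllIn Free Θ U →
             ∀ {B} → B ∈ Θ → members (proj₁ B) Subset.⊆ Z → members (proj₁ B) Subset.⊆ Z ⊖a
    free⊆⊖ h i H⊆Z x∈H = ∈-⊖⁺ (H⊆Z x∈H) (proj₁ (All.lookup (in-boxes h) i) x∈H)

    meeting : ∀ {Σ S x} → AllIn (Lang X Y) Σ S → ¬ ⊩ Σ ∣ S → x ∈ S → CriticalView x →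
              (∀ {G β} → x ≡ R (D G β) → Interpolant [] (R β ∷ unbox (members G) Σ)) →
              Partial Σ S (Meets Σ x)
    meeting {Σ} {S} l ⊮ m (left-var q) A with p ≟ q
    -- A free context does not contain `p`, so this axiom cannot arise.
    ... | yes refl = bottom λ h i → contradiction refl (All.lookup (in-signed h) i)
    ... | no p≢q   = record
      { formula  = ¬ᶠ var q
      ; language = All.lookup (in-signed l) m , p≢q
      ; left     = step (here refl) refl λ where
          (here refl) → ax q (there (there m)) (here refl)
      ; right    = λ h i → step (here refl) refl λ where
          (here refl) → ax q (here refl) (there (there i))
      }
    meeting {Σ} {S} l ⊮ m (right-var q) A with p ≟ q
    ... | yes refl = bottom λ h i → contradiction refl (All.lookup (in-signed h) i)
    ... | no p≢q   = record
      { formula  = var q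
      ; language = All.lookup (in-signed l) m , p≢q
      ; left     = ax q (here refl) (there m)
      ; right    = λ h i → ax q (there i) (here refl)
      }
    meeting l ⊮ m right-⊥ A = bottom λ _ ()
    meeting {Σ} {S} l ⊮ m (right-box G β) A with Subset.nonempty? (members G ⊖a)
    -- No group of Θ fits into G = {a}, so Σ alone would prove D G β.
    ... | no ¬ne = bottom λ {Θ} h d → contradiction
        (modal m (weaken ⊆-refl
          (∷⁺ʳ _ (⊆-trans (unbox-++ {Z₁ = members G ⊖a} Θ (free⊆⊖ h) (λ _ H⊆ → H⊆))
                          (Every-++ (unbox _ Θ) (λ i → contradiction (unbox-empty Θ ¬ne i) λ ()) (λ i → i))))
          d))
        ⊮
    ... | yes ne = record
      { formula  = D T (formula I)
      ; language = (λ x∈T → let x∈G , a≢x = ∈-⊖⁻ (members G) x∈T in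
                            proj₁ (All.lookup (in-signed l) m) x∈G , a≢x) , language I
      -- The T rule stores `D T` of the interpolant among the boxes; as `T` lies inside `G`, the
      -- modal inference on `D G β` releases it.
      ; left     = step (here refl) refl λ where
          (here refl) → modal (there (there m))
            (weaken ⊆-refl
              (∈-∷⁺ʳ (there (∈-unbox⁺ {Σ = (T , formula I) ∷ Σ} (here refl) (proj₁ ∘ ∈-⊖⁻ (members G))))
                (∷⁺ʳ _ (unbox-mono {Σ = Σ} {(T , formula I) ∷ Σ} Subset.⊆-refl there)))
              (left I))
      -- Boxing with `T` instead of `G` loses nothing of `Θ`, by `free⊆⊖`.
      ; right    = λ {Θ} h d → modal (here refl)
          (right I ([] , Lang-unbox Θ (in-boxes h))
            (weaken ⊆-refl
              (∈-∷⁺ʳ (∈-++⁺ʳ (unbox _ Θ) (here refl))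
                (⊆-trans (unbox-++ Θ (free⊆⊖ h) (λ _ H⊆ → H⊆)) (++⁺ʳ (unbox _ Θ) there)))
              d))
      }
      where
      T : Grp n
      T = mkGrp (members G ⊖a) ne
      I = A refl

    -- The last inference is modal with its principal formula in the context. Fixing the member set
    -- `Z` of its group leaves finitely many cases, although contexts are unbounded.
    Boxes : List Bx → Subset n → List Bx → List Signed → Set
    Boxes Σ Z Θ U = ∃₂ λ G β → Z ≡ members G × R (D G β) ∈ U × ⊩ [] ∣ R β ∷ unbox Z (Θ ++ Σ)

    trace : Subset n → List Bx → Subset n
    trace Z Σ = (Z ∩ agents Σ) ⊖a

    trace⊆ : ∀ {Z} Σ → trace Z Σ Subset.⊆ Z
    trace⊆ {Z} Σ = proj₁ ∘ Subset.x∈p∩q⁻ Z (agents Σ) ∘ proj₁ ∘ ∈-⊖⁻ (Z ∩ agents Σ)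

    -- Since `D G β` is free, `G` avoids `a`; hence a group of `Σ` inside `G` lies inside the trace.
    unbox-trace : ∀ {Θ U G β} Σ → AllIn Free Θ U → R (D G β) ∈ U →
                  unbox (members G) (Θ ++ Σ) ⊑ unbox (members G) Θ ++ unbox (trace (members G) Σ) Σ
    unbox-trace {Θ} Σ h m = unbox-++ Θ (λ _ H⊆ → H⊆) λ i H⊆G x∈H →
      ∈-⊖⁺ (Subset.x∈p∩q⁺ (H⊆G x∈H , members⊆agents i x∈H))
           (proj₁ (All.lookup (in-signed h) m) (H⊆G x∈H))

    -- The group G of a boxed formula in the context may contain agents foreign to Σ ∣ S;
    -- its trace on the agents of Σ unboxes the same part of Σ.
    boxing : ∀ {Σ S} → AllIn (Lang X Y) Σ S → (∀ Z → Interpolant [] (unbox Z Σ)) → ∀ Z →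
             Partial Σ S (Boxes Σ Z)
    boxing {Σ} {S} l A Z with Subset.nonempty? (trace Z Σ)
    -- An empty trace unboxes nothing of `Σ`, so the inference already succeeds in the context
    -- alone.
    ... | no ¬ne = bottom λ
          { {Θ} h (G , β , refl , m , d) → modal m (weaken ⊆-refl
            (∷⁺ʳ _ (⊆-trans (unbox-trace Σ h m)
              (Every-++ (unbox _ Θ) (λ i → i) (λ i → contradiction (unbox-empty Σ ¬ne i) λ ()))))
            d) }
    ... | yes ne = record
      { formula  = ¬ᶠ D T (¬ᶠ formula I)
      ; language = (λ x∈T → let x∈ , a≢x = ∈-⊖⁻ (Z ∩ agents Σ) x∈T
                                B , i , x∈B = ∈-agents⁻ Σ (proj₂ (Subset.x∈p∩q⁻ Z _ x∈))
                            in proj₁ (All.lookup (in-boxes l) i) x∈B , a≢x) , language I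
      -- Bottom-up: negation on the left, the modal rule at `T`, then negation on the right brings
      -- the interpolant to the left.
      ; left     = step (here refl) refl λ where
          (here refl) → modal (here refl) (step (here refl) refl λ where
            (here refl) → weaken ⊆-refl (∷⁺ʳ _ there) (left I))
      -- Bottom-up: the box over `T` moves left and is stored by the T rule, then the modal rule for
      -- `D G β` releases its body because the trace lies inside `G`, and the negation puts the
      -- interpolant on the right beside `β`.
      ; right    = λ
          { {Θ} h (G , β , refl , m , d) → step (here refl) refl λ where
            (here refl) → step (here refl) refl λ where
              (here refl) → modal (there (there (there m)))
                (step (there (∈-unbox⁺ {Σ = (T , ¬ᶠ formula I) ∷ Θ} (here refl) (trace⊆ Σ))) refl λ where
                  (here refl) → weaken ⊆-refl
                    (∷⁺ʳ _ (∷⁺ʳ _ (unbox-mono {Σ = Θ} {(T , ¬ᶠ formula I) ∷ Θ} Subset.⊆-refl there)))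
                    (right I ([] , proj₂ (All.lookup (in-signed h) m) ∷ Lang-unbox Θ (in-boxes h))
                      (weaken ⊆-refl (∷⁺ʳ _ (unbox-trace Σ h m)) d))) }
      }
      where
      T : Grp n
      T = mkGrp (trace Z Σ) ne
      I = A (trace Z Σ)

    critical : ∀ {Σ S} → All Critical S →
               (∀ {G β} → R (D G β) ∈ S → Interpolant [] (R β ∷ unbox (members G) Σ)) →
               (∀ Z → Interpolant [] (unbox Z Σ)) →
               AllIn (Lang X Y) Σ S → Interpolant Σ S
    critical {Σ} {S} cs A B l with ⊩? Σ S
    ... | yes d = top d
    ... | no ⊮  = record
      { formula  = formula C
      ; language = language C
      ; left     = left C
      ; right    = λ h → analyse h ⊆-refl ⊆-refl
      }
      where
      C : Partial Σ S λ Θ U → (∃[ x ] x ∈ S × Meets Σ x Θ U) ⊎ (∃[ Z ] Z ∈ subsets n × Boxes Σ Z Θ U)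
      C = either (some S λ m → meeting l ⊮ m (view (All.lookup cs m)) λ { refl → A m })
                 (some (subsets n) λ {Z} _ → boxing l B Z)

      -- Induction on the derivation of the combined sequent. Decompositions in the context are
      -- replayed beside `C`, so `Θ` and `U` grow but stay free, until an axiom closes the context
      -- or an inference covered by `C` is reached.
      analyse : ∀ {Θ U Ψ W} → AllIn Free Θ U → Ψ ⊑ Θ ++ Σ → W ⊑ U ++ S → ⊩ Ψ ∣ W → ⊩ Θ ∣ R (formula C) ∷ U
      analyse {U = U} h Ψ⊆ W⊆ (ax q i j) with ∈-++⁻ U (W⊆ i) | ∈-++⁻ U (W⊆ j)
      ... | inj₁ i′ | inj₁ j′ = ax q (there i′) (there j′)
      ... | inj₁ i′ | inj₂ j′ = right C h (inj₁ (_ , j′ , i′))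
      ... | inj₂ i′ | inj₁ j′ = right C h (inj₁ (_ , i′ , j′))
      -- An axiom inside `S` would make the critical sequent derivable.
      ... | inj₂ i′ | inj₂ j′ = contradiction (ax q i′ j′) ⊮
      analyse {Θ} {U} h Ψ⊆ W⊆ (step {x = x} i e ds) with ∈-++⁻ U (W⊆ i)
      ... | inj₂ j = contradiction refl (critical≢ e (All.lookup cs j))
      ... | inj₁ j = step (there j) e λ {σ} {b} k →
            weaken ⊆-refl (∈-∷⁺ʳ (∈-++⁺ʳ b (here refl)) (++⁺ʳ b there))
              (analyse (AllIn-++ (Closed.branch-closed x e k (All.lookup (in-signed h) j)) h)
                (⊆-trans (++⁺ʳ σ Ψ⊆) (⊆-reflexive (sym (List.++-assoc σ Θ Σ))))
                (⊆-trans (++⁺ʳ b W⊆) (⊆-reflexive (sym (List.++-assoc b U S))))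
                (ds k))
      analyse {U = U} h Ψ⊆ W⊆ (modal {G = G} {β} i d) with ∈-++⁻ U (W⊆ i)
      ... | inj₁ j = right C h (inj₂ (members G , ∈-subsets _ , G , β , refl , j , d′))
        where d′ = weaken ⊆-refl (∷⁺ʳ _ (unbox-mono Subset.⊆-refl Ψ⊆)) d
      ... | inj₂ j = right C h (inj₁ (_ , j , weaken ⊆-refl (∷⁺ʳ _ (unbox-mono Subset.⊆-refl Ψ⊆)) d))

    interpolant : ∀ Σ S → AllIn (Lang X Y) Σ S → Interpolant Σ S
    interpolant = SequentInduction.sequent-induction
        (λ Σ S → AllIn (Lang X Y) Σ S → Interpolant Σ S)
        (λ π A l → let I = A (AllIn-resp π l) in record
          { formula  = formula I
          ; language = language I
          ; left     = weaken ⊆-refl (∷⁺ʳ _ (⊆-reflexive-↭ π)) (left I)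
          ; right    = λ {Θ} {U} h d → right I h (weaken ⊆-refl (++⁺ʳ U (⊆-reflexive-↭ (↭-sym π))) d)
          })
        -- With nothing on its side, the derivation is already one of the context.
        (λ _ → bottom λ {Θ} {U} _ d →
          weaken (⊆-reflexive (List.++-identityʳ Θ)) (⊆-reflexive (List.++-identityʳ U)) d)
        (λ e A l → reduce e λ i → A i (Closed.branches-closed e i l))
        (λ {Σ} cs A B l → critical cs
          (λ m → A m ([] , proj₂ (All.lookup (in-signed l) m) ∷ Lang-unbox Σ (in-boxes l)))
          (λ Z → B Z ([] , Lang-unbox Σ (in-boxes l)))
          l)

  -- Transfer to the original calculus

  -- Bottom-up, the T rule copies each antecedent `D G α` into the box component; the bodies it adds
  -- are covered by weakening. This is how `Θ` changes place in clause (iii).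
  unbox-antecedents : ∀ Θ {Σ S} → Every (λ B → L (uncurry D B) ∈ S) Θ → ⊩ Θ ++ Σ ∣ S → ⊩ Σ ∣ S
  unbox-antecedents []      f d = d
  unbox-antecedents (B ∷ Θ) f d = unbox-antecedents Θ (f ∘ there) (step (f (here refl)) refl λ where
    (here refl) → weaken ⊆-refl there d)

  signed : List Fm → List Fm → List Signed
  signed Γ Δ = map L Γ ++ map R Δ

  lefts-signed : ∀ Γ Δ → lefts (signed Γ Δ) ≡ Γ
  lefts-signed []      []      = refl
  lefts-signed []      (β ∷ Δ) = lefts-signed [] Δ
  lefts-signed (α ∷ Γ) Δ       = cong (α ∷_) (lefts-signed Γ Δ)

  rights-signed : ∀ Γ Δ → rights (signed Γ Δ) ≡ Δ
  rights-signed []      []      = refl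
  rights-signed []      (β ∷ Δ) = cong (β ∷_) (rights-signed [] Δ)
  rights-signed (α ∷ Γ) Δ       = rights-signed Γ Δ

  ⊩⇒⊢ : ∀ {Σ S} Γ Δ → S ⊑ signed Γ Δ → ⊩ Σ ∣ S → ⊢ Σ ∣ Γ ⇒ Δ
  ⊩⇒⊢ Γ Δ S⊆ d = ≋ refl (↭-reflexive (lefts-signed Γ Δ)) (↭-reflexive (rights-signed Γ Δ))
    (⊩⇒⊢ˢ d ⊆-refl (member ∘ S⊆))

  ∈-signedˡ : ∀ {Γ} Δ {α} → α ∈ Γ → L α ∈ signed Γ Δ
  ∈-signedˡ Δ m = ∈-++⁺ˡ (∈-map⁺ L m)

  ∈-signedʳ : ∀ Γ {Δ α} → α ∈ Δ → R α ∈ signed Γ Δ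
  ∈-signedʳ Γ m = ∈-++⁺ʳ (map L Γ) (∈-map⁺ R m)

  signed-⊑ : ∀ {Γ Γ′ Δ Δ′} → Γ ⊑ Γ′ → Δ ⊑ Δ′ → signed Γ Δ ⊑ signed Γ′ Δ′
  signed-⊑ Γ⊆ Δ⊆ = ++⁺ (map⁺ L Γ⊆) (map⁺ R Δ⊆)

  Lang-sequent : ∀ {X Y} Σ Γ Δ → (∀ {α} → α ∈ boxes Σ ⊎ α ∈ Γ ⊎ α ∈ Δ → Lang X Y α) →
                 AllIn (Lang X Y) Σ (signed Γ Δ)
  Lang-sequent Σ Γ Δ f =
    All.tabulate (λ m → f (inj₁ (∈-map⁺ (uncurry D) m))) ,
    All.++⁺ (All.map⁺ (All.tabulate (λ m → f (inj₂ (inj₁ m)))))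
            (All.map⁺ (All.tabulate (λ m → f (inj₂ (inj₂ m)))))

theorem6p18 : (m : ℕ) (Var : Set) → Var ↣ ℕ →
    (Γ Δ : List (Form (suc m) Var)) (Σ : List (Boxed (suc m) Var)) (p : Var) (a : Fin (suc m)) →
    ∃[ A ]
    ((V A ⊆ V* (boxes Σ ++ Γ ++ Δ) ∖ ｛ p ｝) × (Agt A ⊆ Agt* (boxes Σ ++ Γ ++ Δ) ∖ ｛ a ｝))
    × (⊢ Σ ∣ A ∷ Γ ⇒ Δ)
    × ((Π Λ : List (Form (suc m) Var)) (Θ : List (Boxed (suc m) Var)) →
    p ∉ V* (Π ++ Λ ++ boxes Θ) → a ∉ Agt* (Π ++ Λ ++ boxes Θ) →
    ⊢ Θ ++ Σ ∣ Π ++ Γ ⇒ Δ ++ Λ →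
    ⊢ [] ∣ boxes Θ ++ Π ⇒ A ∷ Λ)
theorem6p18 m Var inj Γ Δ Σ p a =
  formula I ,
  (Lang⇒V⊆ (formula I) (language I) , Lang⇒Agt⊆ (formula I) (language I)) ,
  ⊩⇒⊢ (formula I ∷ Γ) Δ ⊆-refl (left I) ,
  converse
  where
  open Calculus
  open Interpolation (via-injection inj ℕ._≟_) p a (V* (boxes Σ ++ Γ ++ Δ)) (Agt* (boxes Σ ++ Γ ++ Δ))
  open Partial

  occurs : ∀ {α} → α ∈ boxes Σ ⊎ α ∈ Γ ⊎ α ∈ Δ → α ∈ boxes Σ ++ Γ ++ Δ
  occurs (inj₁ i)        = ∈-++⁺ˡ i
  occurs (inj₂ (inj₁ i)) = ∈-++⁺ʳ (boxes Σ) (∈-++⁺ˡ i)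
  occurs (inj₂ (inj₂ i)) = ∈-++⁺ʳ (boxes Σ) (∈-++⁺ʳ Γ i)

  I : Interpolant Σ (signed Γ Δ)
  I = interpolant Σ (signed Γ Δ) (Lang-sequent Σ Γ Δ λ {α} i →
        ⊆⇒Lang α (λ v → lose (occurs i) v) (λ v → lose (occurs i) v))

  converse : ∀ Π Λ Θ → p ∉ V* (Π ++ Λ ++ boxes Θ) → a ∉ Agt* (Π ++ Λ ++ boxes Θ) →
             ⊢ Θ ++ Σ ∣ Π ++ Γ ⇒ Δ ++ Λ → ⊢ [] ∣ boxes Θ ++ Π ⇒ formula I ∷ Λ
  converse Π Λ Θ p∉ a∉ d =
    -- From the inside out: the derivation is embedded, `right` removes the given sequent in favour
    -- of the interpolant, and `Θ` moves into the antecedent.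
    ⊩⇒⊢ Γ′ Δ′ ⊆-refl
      (unbox-antecedents Θ (λ i → ∈-signedˡ Δ′ (∈-++⁺ˡ (∈-map⁺ (uncurry D) i)))
        (weaken (⊆-reflexive (sym (List.++-identityʳ Θ)))
          (∈-∷⁺ʳ (∈-signedʳ Γ′ (here refl)) (signed-⊑ (xs⊆ys++xs Π (boxes Θ)) there))
          (right I free (embed d antecedents succedents))))
    where
    Γ′ Δ′ : List (Form (suc m) Var)
    Γ′ = boxes Θ ++ Π
    Δ′ = formula I ∷ Λ

    occurs′ : ∀ {α} → α ∈ boxes Θ ⊎ α ∈ Π ⊎ α ∈ Λ → α ∈ Π ++ Λ ++ boxes Θ
    occurs′ (inj₁ i)        = ∈-++⁺ʳ Π (∈-++⁺ʳ Λ i)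
    occurs′ (inj₂ (inj₁ i)) = ∈-++⁺ˡ i
    occurs′ (inj₂ (inj₂ i)) = ∈-++⁺ʳ Π (∈-++⁺ˡ i)

    free : AllIn Free Θ (signed Π Λ)
    free = Lang-sequent Θ Π Λ λ {α} i → ⊆⇒Lang α
      (λ { v refl → p∉ (lose (occurs′ i) v) })
      (λ { v refl → a∉ (lose (occurs′ i) v) })

    antecedents : Every (λ α → L α ∈ signed Π Λ ++ signed Γ Δ) (Π ++ Γ)
    antecedents m with ∈-++⁻ Π m
    ... | inj₁ i = ∈-++⁺ˡ (∈-signedˡ Λ i)
    ... | inj₂ i = ∈-++⁺ʳ (signed Π Λ) (∈-signedˡ Δ i)

    succedents : Every (λ α → R α ∈ signed Π Λ ++ signed Γ Δ) (Δ ++ Λ)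
    succedents m with ∈-++⁻ Δ m
    ... | inj₁ i = ∈-++⁺ʳ (signed Π Λ) (∈-signedʳ Γ i)
    ... | inj₂ i = ∈-++⁺ˡ (∈-signedʳ Π i)
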